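{- Let $d\ge 1$ and $n>2d$ be integers and let $\Delta$ be a traceable $d$-dimensional simplicial complex on $n$ vertices. (1) Suppose that there is a labeling of the vertices of $\Delta$ by $1,\dots,n$ that makes $\Delta$ traceable and for which the two sets $\sigma=\{1,\dots,d\}$ (first $d$ vertices) and $\tau=\{n-d+1,\dots,n\}$ (last $d$ vertices) satisfy $d_\sigma+d_\tau\ge n$. Then $\Delta$ is weakly-Hamiltonian. (2) In particular, if $\Delta$ is moreover pure and every $(d-1)$-face of $\Delta$ belongs to at least $\frac n2$ facets of $\Delta$, then $\Delta$ is weakly-Hamiltonian.
   Context: A labeling of a simplicial complex with $n$ vertices is a bijection of its vertex set with $\{1,\dots,n\}$. Given a labeling, for $i\in\{1,\dots,n\}$ let $H_i$ be the $(d+1)$-element set $\{i,i+1,\dots,i+d\}$, where labels are read modulo $n$ (so $n+1$ means $1$, etc.); for $i\le n-d$ no reduction is needed. A labeling makes $\Delta$ traceable if $H_1,\dots,H_{n-d}$ are all faces of $\Delta$; $\Delta$ is traceable if some labeling makes it traceable. $\Delta$ is weakly-Hamiltonian if it has a labeling for which there are indices $1\le i_1<\dots<i_k\le n$ such that $H_{i_1},\dots,H_{i_k}$ are faces of $\Delta$, together they cover all vertices, $H_{i_j}\cap H_{i_{j+1}}\neq\emptyset$ for each $j\in\{1,\dots,k-1\}$, and $H_{i_k}\cap H_{i_1}\ne\emptyset$. For a $(d-1)$-face $\rho$ of $\Delta$, its degree $d_\rho$ is the number of $d$-faces of $\Delta$ containing $\rho$. -}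

module Defs where

open import Data.Bool.Properties using () renaming (_≟_ to _≟ᵇ_)
open import Data.Fin as Fin using (Fin; toℕ; fromℕ; inject₁)
open import Data.Fin.Permutation using (Permutation′; _⟨$⟩ˡ_)
open import Data.Fin.Properties using (nonZeroIndex)
open import Data.Fin.Subset using (Subset; inside; outside; _∈_; _⊆_; _∩_; ⋃; ⁅_⁆; ∣_∣; Nonempty)
open import Data.Fin.Subset.Properties using (_⊆?_; anySubset?)
open import Data.List using (List; []; _∷_; _++_; map; filter; length; upTo; allFin)
open import Data.Nat using (ℕ; zero; suc; _+_; _≤_; _<_; _≟_; _<?_; _≤?_)
open import Data.Nat.DivMod using (_mod_)
open import Data.Product using (∃-syntax; _×_; _,_)
open import Data.Vec using ([]; _∷_)
open import Data.Vec.Properties using (≡-dec)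
open import Level using (0ℓ)
open import Relation.Binary.PropositionalEquality using (_≡_)
open import Relation.Nullary using (Dec; ¬_; ¬?)
open import Relation.Nullary.Decidable using (_×-dec_; map′; decidable-stable)
open import Relation.Unary using (Pred; Decidable)

-- The vertex set is Fin n, and every element of it is a vertex.  The empty
-- face is obtained from `closed` as soon as n ≥ 1.
record SimplicialComplex (n : ℕ) : Set₁ where
  field
    Face   : Pred (Subset n) 0ℓ
    Face?  : Decidable Face
    vertex : ∀ v → Face ⁅ v ⁆
    closed : ∀ {s t} → s ⊆ t → Face t → Face s

subsets : ∀ n → List (Subset n)
subsets zero    = [] ∷ []
subsets (suc n) = map (inside ∷_) (subsets n) ++ map (outside ∷_) (subsets n)

count : ∀ {n} {P : Pred (Subset n) 0ℓ} → Decidable P → ℕ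
count {n} P? = length (filter P? (subsets n))

-- Position i : Fin n stands for the label i + 1 of {1,…,n}.  A labeling sends
-- vertices to positions, so `L ⟨$⟩ˡ i` is the vertex at position i.
Labeling : ℕ → Set
Labeling = Permutation′

verticesAt : ∀ {n} → Labeling n → List (Fin n) → Subset n
verticesAt L is = ⋃ (map (λ i → ⁅ L ⟨$⟩ˡ i ⁆) is)

-- `H d L i` is the set of vertices labeled i+1, …, i+1+d (mod n).
H : ∀ {n} → ℕ → Labeling n → Fin n → Subset n
H {n} d L i = verticesAt L (map (λ j → _mod_ (toℕ i + j) n ⦃ nonZeroIndex i ⦄) (upTo (suc d)))

firstVertices : ∀ {n} → ℕ → Labeling n → Subset n
firstVertices {n} d L = verticesAt L (filter (λ i → toℕ i <? d) (allFin n))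

lastVertices : ∀ {n} → ℕ → Labeling n → Subset n
lastVertices {n} d L = verticesAt L (filter (λ i → n ≤? toℕ i + d) (allFin n))

module _ {n : ℕ} (Δ : SimplicialComplex n) where
  open SimplicialComplex Δ

  -- A face of dimension k has k + 1 elements.
  IsFaceOfDim : ℕ → Pred (Subset n) 0ℓ
  IsFaceOfDim k s = Face s × ∣ s ∣ ≡ suc k

  HasDimension : ℕ → Set
  HasDimension d = (∃[ s ] IsFaceOfDim d s) × (∀ s → Face s → ∣ s ∣ ≤ suc d)

  IsFacet : Pred (Subset n) 0ℓ
  IsFacet s = Face s × (∀ t → Face t → s ⊆ t → s ≡ t)

  IsFacet? : Decidable IsFacet
  IsFacet? s = Face? s ×-dec maximal?
    where
    _≟ˢ_ : (s t : Subset n) → Dec (s ≡ t)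
    _≟ˢ_ = ≡-dec _≟ᵇ_

    Larger : Pred (Subset n) 0ℓ
    Larger t = Face t × s ⊆ t × ¬ (s ≡ t)

    larger? : Decidable Larger
    larger? t = Face? t ×-dec (s ⊆? t) ×-dec ¬? (s ≟ˢ t)

    to : ¬ (∃[ t ] Larger t) → ∀ t → Face t → s ⊆ t → s ≡ t
    to none t ft s⊆t = decidable-stable (s ≟ˢ t) (λ s≢t → none (t , ft , s⊆t , s≢t))

    from : (∀ t → Face t → s ⊆ t → s ≡ t) → ¬ (∃[ t ] Larger t)
    from max (t , ft , s⊆t , s≢t) = s≢t (max t ft s⊆t)

    maximal? : Dec (∀ t → Face t → s ⊆ t → s ≡ t)
    maximal? = map′ to from (¬? (anySubset? larger?))

  Pure : Set
  Pure = ∀ s t → IsFacet s → IsFacet t → ∣ s ∣ ≡ ∣ t ∣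

  -- The number of d-faces containing ρ; meant for (d-1)-faces ρ.
  degree : ℕ → Subset n → ℕ
  degree d ρ = count (λ s → (Face? s ×-dec (∣ s ∣ ≟ suc d)) ×-dec (ρ ⊆? s))

  facetsContaining : Subset n → ℕ
  facetsContaining ρ = count (λ s → IsFacet? s ×-dec (ρ ⊆? s))

  -- 1 ≤ i + 1 ≤ n - d for the label i + 1 reads i + d < n.
  MakesTraceable : ℕ → Labeling n → Set
  MakesTraceable d L = ∀ (i : Fin n) → toℕ i + d < n → Face (H d L i)

  Traceable : ℕ → Set
  Traceable d = ∃[ L ] MakesTraceable d L

  -- The indices i₁ < … < i_k are given by a function on Fin (suc m), k = suc m;
  -- k = 0 is impossible because the H's have to cover the vertices.
  record WeaklyHamiltonian (d : ℕ) : Set where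
    field
      labeling   : Labeling n
      m          : ℕ
      index      : Fin (suc m) → Fin n
      increasing : ∀ a b → a Fin.< b → index a Fin.< index b
      faces      : ∀ a → Face (H d labeling (index a))
      covers     : ∀ v → ∃[ a ] v ∈ H d labeling (index a)
      consecutive : ∀ (j : Fin m) →
        Nonempty (H d labeling (index (inject₁ j)) ∩ H d labeling (index (Fin.suc j)))
      closing    : Nonempty (H d labeling (index (fromℕ m)) ∩ H d labeling (index Fin.zero))

{-# OPTIONS --safe #-}

-- Ore's argument.  A d-face containing σ is σ plus a vertex after the first d
-- positions, and similarly for τ.  Shifting the extra vertices of σ one
-- position back gives d_σ + d_τ ≥ n marks on the first n - 1 positions, so
-- some i has both σ ∪ {i} and τ ∪ {i - 1} as faces.  Relabeling the path as
-- 1, …, i - 1, n, n - 1, …, i makes these two faces windows that close it up.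
module Submission where

open import Defs
open import Data.Bool using (true; false)
open import Data.Fin as Fin using (Fin; toℕ; fromℕ<; splitAt)
open import Data.Fin.Permutation using (permutation; _⟨$⟩ˡ_; _⟨$⟩ʳ_; _∘ₚ_; inverseˡ; inverseʳ)
open import Data.Fin.Properties using (any?; pigeonhole; toℕ-injective; toℕ-fromℕ<; toℕ<n; toℕ-fromℕ; toℕ-inject₁; splitAt⁻¹-↑ˡ; splitAt⁻¹-↑ʳ)
import Data.Fin.Properties as Fin
open import Data.Fin.Subset using (Subset; inside; outside; _∈_; _∉_; _⊆_; _∪_; _∩_; _-_; ⊥; ⁅_⁆; ∣_∣; Nonempty)
open import Data.Fin.Subset.Properties
open import Data.List using (List; []; _∷_; filter; length; lookup; upTo; allFin)
open import Data.List.Membership.Propositional renaming (_∈_ to _∈ˡ_) using ()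
open import Data.List.Membership.Propositional.Properties using (∈-map⁺; ∈-map⁻; ∈-filter⁺; ∈-filter⁻; ∈-upTo⁺; ∈-upTo⁻; ∈-allFin; ∈-lookup)
open import Data.List.Relation.Unary.All as All using ()
open import Data.List.Relation.Unary.AllPairs using ([]; _∷_)
open import Data.List.Relation.Unary.Any using (here; there)
open import Data.List.Relation.Unary.Unique.Propositional using (Unique)
import Data.List.Relation.Unary.Unique.Propositional.Properties as Unique
open import Data.Nat using (ℕ; zero; suc; _+_; _*_; _∸_; _≤_; _<_; z≤n; s≤s; s≤s⁻¹; _<?_; _≤?_; _≟_)
open import Data.Nat.DivMod using (_mod_; _%_; m<n⇒m%n≡m; [m+n]%n≡m%n)
open import Data.Nat.Properties
open import Data.Nat.Tactic.RingSolver using (solve-∀)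
open import Data.Product using (_×_; _,_; ∃-syntax; proj₁; proj₂)
open import Data.Sum using (inj₁; inj₂; [_,_]′)
open import Data.Vec using (_∷_)
open import Data.Vec.Properties using (∷-injectiveʳ)
open import Function using (_∘_; Injective)
open import Level using (0ℓ)
open import Relation.Binary.PropositionalEquality using (_≡_; refl; sym; trans; cong; subst; subst₂)
open import Relation.Nullary using (¬_; yes; no; contradiction)
open import Relation.Nullary.Decidable using (_×-dec_; ¬?; decidable-stable)
open import Relation.Unary using (Pred; Decidable)

-- Finite sets and lists

∣⁅x⁆∪p∣≤1+∣p∣ : ∀ {n} (x : Fin n) (p : Subset n) → ∣ ⁅ x ⁆ ∪ p ∣ ≤ suc ∣ p ∣
∣⁅x⁆∪p∣≤1+∣p∣ Fin.zero (s ∷ p) rewrite ∪-identityˡ p = s≤s (∣p∣≤∣x∷p∣ s p)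
∣⁅x⁆∪p∣≤1+∣p∣ (Fin.suc x) (true  ∷ p) = s≤s (∣⁅x⁆∪p∣≤1+∣p∣ x p)
∣⁅x⁆∪p∣≤1+∣p∣ (Fin.suc x) (false ∷ p) = ∣⁅x⁆∪p∣≤1+∣p∣ x p

x∈p⇒∣p∣≡1+∣p-x∣ : ∀ {n} {x : Fin n} {p} → x ∈ p → ∣ p ∣ ≡ suc ∣ p - x ∣
x∈p⇒∣p∣≡1+∣p-x∣ {x = x} {p} x∈p = ≤-antisym
  (≤-trans (p⊆q⇒∣p∣≤∣q∣ split) (∣⁅x⁆∪p∣≤1+∣p∣ x (p - x)))
  (x∈p⇒∣p-x∣<∣p∣ x∈p)
  where
  split : p ⊆ ⁅ x ⁆ ∪ (p - x)
  split {y} y∈p with y Fin.≟ x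
  ... | yes refl = x∈p∪q⁺ (inj₁ (x∈⁅x⁆ x))
  ... | no  y≢x  = x∈p∪q⁺ (inj₂ (x∈p∧x≢y⇒x∈p-y y∈p y≢x))

-- Deleting `x` twice is the same as deleting it once, so the second deletion cannot lower the
-- cardinality, as it would if `x` were still present.
x∉p-x : ∀ {n} {x : Fin n} (p : Subset n) → x ∉ p - x
x∉p-x {x = x} p x∈ = <-irrefl refl (subst (_< ∣ p - x ∣) (cong ∣_∣ (p─q─q≡p─q p ⁅ x ⁆)) (x∈p⇒∣p-x∣<∣p∣ x∈))

-- Induction on `d`: deleting `e Fin.zero` from `p` costs one element and, as `e` is injective,
-- leaves exactly the image of `e ∘ Fin.suc`.
∣image∣ : ∀ {d n} (e : Fin d → Fin n) → Injective _≡_ _≡_ e → ∀ p →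
          (∀ j → e j ∈ p) → (∀ {v} → v ∈ p → ∃[ j ] v ≡ e j) → ∣ p ∣ ≡ d
∣image∣ {zero} {n} e inj p e∈p p⊆e =
  n≤0⇒n≡0 (subst (∣ p ∣ ≤_) (∣⊥∣≡0 n) (p⊆q⇒∣p∣≤∣q∣ {q = ⊥} λ v∈p → contradiction (proj₁ (p⊆e v∈p)) λ ()))
∣image∣ {suc d} e inj p e∈p p⊆e =
  trans (x∈p⇒∣p∣≡1+∣p-x∣ (e∈p Fin.zero))
    (cong suc (∣image∣ (e ∘ Fin.suc) (Fin.suc-injective ∘ inj) (p - e Fin.zero)
    (λ j → x∈p∧x≢y⇒x∈p-y (e∈p (Fin.suc j)) (λ eq → contradiction (inj eq) λ ()))
    rest))
  where
  rest : ∀ {v} → v ∈ p - e Fin.zero → ∃[ j ] v ≡ e (Fin.suc j)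
  rest v∈ with p⊆e (p─q⊆p p _ v∈)
  ... | Fin.zero  , refl = contradiction v∈ (x∉p-x p)
  ... | Fin.suc j , eq   = j , eq

p⊆q∧∣q∣≤∣p∣⇒p≡q : ∀ {n} {p q : Subset n} → p ⊆ q → ∣ q ∣ ≤ ∣ p ∣ → p ≡ q
p⊆q∧∣q∣≤∣p∣⇒p≡q {p = p} {q} p⊆q ∣q∣≤∣p∣ = ⊆-antisym p⊆q λ {x} x∈q →
  decidable-stable (x ∈? p) λ x∉p → <⇒≱ (p⊂q⇒∣p∣<∣q∣ (p⊆q , x , x∈q , x∉p)) ∣q∣≤∣p∣

∣p∣<∣q∣⇒∃ : ∀ {n} (p q : Subset n) → ∣ p ∣ < ∣ q ∣ → ∃[ x ] (x ∈ q × x ∉ p)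
∣p∣<∣q∣⇒∃ p q ∣p∣<∣q∣ with any? (λ x → (x ∈? q) ×-dec ¬? (x ∈? p))
... | yes found = found
... | no  none  = contradiction
  (p⊆q⇒∣p∣≤∣q∣ λ {x} x∈q → decidable-stable (x ∈? p) λ x∉p → none (x , x∈q , x∉p))
  (<⇒≱ ∣p∣<∣q∣)

-- Pigeonhole on the disjoint union of the two domains; injectivity rules out a collision within one
-- summand.
injections-meet : ∀ {a b m} (f : Fin a → Fin m) (g : Fin b → Fin m) →
                  Injective _≡_ _≡_ f → Injective _≡_ _≡_ g → m < a + b →
                  ∃[ i ] ∃[ j ] f i ≡ g j
injections-meet {a} f g f-inj g-inj m<a+b
  with x , y , x<y , eq ← pigeonhole m<a+b ([ f , g ]′ ∘ splitAt a)
  with splitAt a x in eqx | splitAt a y in eqy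
... | inj₁ i | inj₂ j = i , j , eq
... | inj₂ j | inj₁ i = i , j , sym eq
... | inj₁ i | inj₁ j = contradiction
  (trans (sym (splitAt⁻¹-↑ˡ eqx)) (trans (cong (Fin._↑ˡ _) (f-inj eq)) (splitAt⁻¹-↑ˡ eqy)))
  (Fin.<⇒≢ x<y)
... | inj₂ i | inj₂ j = contradiction
  (trans (sym (splitAt⁻¹-↑ʳ {m = a} eqx)) (trans (cong (a Fin.↑ʳ_) (g-inj eq)) (splitAt⁻¹-↑ʳ {m = a} eqy)))
  (Fin.<⇒≢ x<y)

lookup-injective : ∀ {A : Set} {xs : List A} → Unique xs → Injective _≡_ _≡_ (lookup xs)
lookup-injective (px ∷ u) {Fin.zero}  {Fin.zero}  eq = refl
lookup-injective (px ∷ u) {Fin.zero}  {Fin.suc j} eq = contradiction eq (All.lookup px (∈-lookup j))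
lookup-injective (px ∷ u) {Fin.suc i} {Fin.zero}  eq = contradiction (sym eq) (All.lookup px (∈-lookup i))
lookup-injective (px ∷ u) {Fin.suc i} {Fin.suc j} eq = cong Fin.suc (lookup-injective u eq)

length-filter-mono : ∀ {A : Set} {P Q : Pred A 0ℓ} (P? : Decidable P) (Q? : Decidable Q) →
                     (∀ {x} → P x → Q x) → ∀ xs → length (filter P? xs) ≤ length (filter Q? xs)
length-filter-mono P? Q? P⇒Q [] = z≤n
length-filter-mono P? Q? P⇒Q (x ∷ xs) with P? x | Q? x
... | yes _  | yes _  = s≤s (length-filter-mono P? Q? P⇒Q xs)
... | yes px | no ¬qx = contradiction (P⇒Q px) ¬qx
... | no _   | yes _  = m≤n⇒m≤1+n (length-filter-mono P? Q? P⇒Q xs)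
... | no _   | no _   = length-filter-mono P? Q? P⇒Q xs

-- Ensures that different indices into a filtered list of subsets, whose length is a degree, give
-- different faces.
subsets-unique : ∀ n → Unique (subsets n)
subsets-unique zero    = All.[] ∷ []
subsets-unique (suc n) = Unique.++⁺
  (Unique.map⁺ ∷-injectiveʳ (subsets-unique n))
  (Unique.map⁺ ∷-injectiveʳ (subsets-unique n))
  λ { (in∈ , out∈) → clash (∈-map⁻ _ in∈) (∈-map⁻ _ out∈) }
  where
  clash : ∀ {v : Subset (suc n)} → ∃[ s ] (s ∈ˡ subsets n × v ≡ inside ∷ s) →
          ¬ (∃[ s ] (s ∈ˡ subsets n × v ≡ outside ∷ s))
  clash (_ , _ , refl) (_ , _ , ())

-- Vertices and windows of a labeling

L[i]∈verticesAt : ∀ {n} (L : Labeling n) {i is} → i ∈ˡ is → L ⟨$⟩ˡ i ∈ verticesAt L is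
L[i]∈verticesAt L (here refl) = x∈p∪q⁺ (inj₁ (x∈⁅x⁆ _))
L[i]∈verticesAt L (there i∈)  = x∈p∪q⁺ (inj₂ (L[i]∈verticesAt L i∈))

verticesAt⊆ : ∀ {n} (L : Labeling n) is {s} → (∀ {i} → i ∈ˡ is → L ⟨$⟩ˡ i ∈ s) → verticesAt L is ⊆ s
verticesAt⊆ L []       in-s v∈ = contradiction v∈ ∉⊥
verticesAt⊆ L (i ∷ is) {s} in-s v∈ with x∈p∪q⁻ ⁅ L ⟨$⟩ˡ i ⁆ _ v∈
... | inj₁ v∈i  = subst (_∈ s) (sym (x∈⁅y⁆⇒x≡y _ v∈i)) (in-s (here refl))
... | inj₂ v∈is = verticesAt⊆ L is (in-s ∘ there) v∈is

∈verticesAt⁻ : ∀ {n} (L : Labeling n) is {v} → v ∈ verticesAt L is → L ⟨$⟩ʳ v ∈ˡ is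
∈verticesAt⁻ L []       v∈ = contradiction v∈ ∉⊥
∈verticesAt⁻ L (i ∷ is) v∈ with x∈p∪q⁻ ⁅ L ⟨$⟩ˡ i ⁆ _ v∈
... | inj₁ v∈i  rewrite x∈⁅y⁆⇒x≡y _ v∈i = here (inverseʳ L)
... | inj₂ v∈is = there (∈verticesAt⁻ L is v∈is)

-- A labeling is a bijection, so sending `j` to the vertex at position `x + j` lists `p` without
-- repetition. Both ends of the path use this, with `x` equal to 0 and to `n ∸ d`.
∣block∣ : ∀ {n} (L : Labeling n) x d p → x + d ≤ n →
          (∀ i → x ≤ toℕ i → toℕ i < x + d → L ⟨$⟩ˡ i ∈ p) →
          (∀ {v} → v ∈ p → x ≤ toℕ (L ⟨$⟩ʳ v) × toℕ (L ⟨$⟩ʳ v) < x + d) →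
          ∣ p ∣ ≡ d
∣block∣ {n} L x d p x+d≤n block⊆p p⊆block = ∣image∣ (λ j → L ⟨$⟩ˡ pos j) inj p
  (λ j → block⊆p (pos j) (subst (x ≤_) (sym (toℕ-pos j)) (m≤m+n x (toℕ j)))
                         (subst (_< x + d) (sym (toℕ-pos j)) (+-monoʳ-< x (toℕ<n j))))
  onto
  where
  pos : Fin d → Fin n
  pos j = fromℕ< (<-≤-trans (+-monoʳ-< x (toℕ<n j)) x+d≤n)
  toℕ-pos : ∀ j → toℕ (pos j) ≡ x + toℕ j
  toℕ-pos j = toℕ-fromℕ< _
  inj : Injective _≡_ _≡_ (λ j → L ⟨$⟩ˡ pos j)
  inj {i} {j} eq = toℕ-injective (+-cancelˡ-≡ x _ _ (trans (sym (toℕ-pos i)) (trans (cong toℕ pos≡) (toℕ-pos j))))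
    where
    pos≡ : pos i ≡ pos j
    pos≡ = trans (sym (inverseʳ L)) (trans (cong (L ⟨$⟩ʳ_) eq) (inverseʳ L))
  onto : ∀ {v} → v ∈ p → ∃[ j ] v ≡ L ⟨$⟩ˡ pos j
  onto {v} v∈p with p⊆block v∈p
  ... | x≤ , <x+d with m≤n⇒∃[o]m+o≡n x≤
  ... | o , x+o≡ = fromℕ< o<d , trans (sym (inverseˡ L)) (cong (L ⟨$⟩ˡ_) (toℕ-injective
          (trans (sym x+o≡) (trans (cong (x +_) (sym (toℕ-fromℕ< o<d))) (sym (toℕ-pos _))))))
    where
    o<d : o < d
    o<d = +-cancelˡ-< x o d (subst (_< x + d) (sym x+o≡) <x+d)

module _ {n} (d : ℕ) (L : Labeling n) where

  first⁺ : ∀ i → toℕ i < d → L ⟨$⟩ˡ i ∈ firstVertices d L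
  first⁺ i i<d = L[i]∈verticesAt L (∈-filter⁺ (λ i → toℕ i <? d) (∈-allFin i) i<d)

  first⁻ : ∀ {v} → v ∈ firstVertices d L → toℕ (L ⟨$⟩ʳ v) < d
  first⁻ v∈ = proj₂ (∈-filter⁻ (λ i → toℕ i <? d) {xs = allFin n} (∈verticesAt⁻ L _ v∈))

  last⁺ : ∀ i → n ≤ toℕ i + d → L ⟨$⟩ˡ i ∈ lastVertices d L
  last⁺ i n≤ = L[i]∈verticesAt L (∈-filter⁺ (λ i → n ≤? toℕ i + d) (∈-allFin i) n≤)

  last⁻ : ∀ {v} → v ∈ lastVertices d L → n ≤ toℕ (L ⟨$⟩ʳ v) + d
  last⁻ v∈ = proj₂ (∈-filter⁻ (λ i → n ≤? toℕ i + d) {xs = allFin n} (∈verticesAt⁻ L _ v∈))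

  ∣first∣ : d ≤ n → ∣ firstVertices d L ∣ ≡ d
  ∣first∣ d≤n = ∣block∣ L 0 d _ d≤n (λ i _ → first⁺ i) (λ v∈ → z≤n , first⁻ v∈)

  ∣last∣ : d ≤ n → ∣ lastVertices d L ∣ ≡ d
  ∣last∣ d≤n = ∣block∣ L (n ∸ d) d _ (≤-reflexive n∸d+d≡n)
    (λ i n∸d≤i _ → last⁺ i (subst (_≤ toℕ i + d) n∸d+d≡n (+-monoˡ-≤ d n∸d≤i)))
    (λ {v} v∈ → m≤n+o⇒m∸n≤o n d (subst (n ≤_) (+-comm _ d) (last⁻ v∈))
              , subst (toℕ (L ⟨$⟩ʳ v) <_) (sym n∸d+d≡n) (toℕ<n _))
    where
    n∸d+d≡n : n ∸ d + d ≡ n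
    n∸d+d≡n = m∸n+n≡m d≤n

-- Positions as natural numbers modulo n

module _ {n′ : ℕ} where

  private
    n : ℕ
    n = suc n′

  toℕ-mod : ∀ {p} → p < n → toℕ (p mod n) ≡ p
  toℕ-mod {p} p<n = trans (toℕ-fromℕ< _) (m<n⇒m%n≡m p<n)

  mod-cong : ∀ p q → p % n ≡ q % n → p mod n ≡ q mod n
  mod-cong p q eq = toℕ-injective (trans (toℕ-fromℕ< _) (trans eq (sym (toℕ-fromℕ< _))))

  toℕ-mod-id : ∀ (i : Fin n) → toℕ i mod n ≡ i
  toℕ-mod-id i = toℕ-injective (toℕ-mod (toℕ<n i))

  -- Reading positions modulo `n` lets a window that runs past the end be treated as an interval of
  -- natural numbers.
  vertexAt : Labeling n → ℕ → Fin n
  vertexAt L p = L ⟨$⟩ˡ (p mod n)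

  vertexAt-toℕ : ∀ L (i : Fin n) → vertexAt L (toℕ i) ≡ L ⟨$⟩ˡ i
  vertexAt-toℕ L i = cong (L ⟨$⟩ˡ_) (toℕ-mod-id i)

  vertexAt-position : ∀ L v → vertexAt L (toℕ (L ⟨$⟩ʳ v)) ≡ v
  vertexAt-position L v = trans (vertexAt-toℕ L _) (inverseˡ L)

  -- Written from the last position `n′`, because the wrap-around arguments all concern the window
  -- that starts there.
  vertexAt-wrap : ∀ L p → vertexAt L (n′ + suc p) ≡ vertexAt L p
  vertexAt-wrap L p = cong (L ⟨$⟩ˡ_) (mod-cong (n′ + suc p) p
    (trans (cong (_% n) (trans (+-comm n′ (suc p)) (sym (+-suc p n′)))) ([m+n]%n≡m%n p n)))

  vertexAt∈H : ∀ d L p {j} → p < n → j ≤ d → vertexAt L (p + j) ∈ H d L (p mod n)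
  vertexAt∈H d L p {j} p<n j≤d =
    subst (λ q → vertexAt L (q + j) ∈ H d L (p mod n)) (toℕ-mod p<n)
      (L[i]∈verticesAt L (∈-map⁺ _ (∈-upTo⁺ (s≤s j≤d))))

  vertexAt∈H₀ : ∀ d L p → p < n → vertexAt L p ∈ H d L (p mod n)
  vertexAt∈H₀ d L p p<n =
    subst (λ q → vertexAt L q ∈ H d L (p mod n)) (+-identityʳ p) (vertexAt∈H d L p p<n z≤n)

  -- Together with `closed`, this reduces showing that a window is a face to checking its `d + 1`
  -- positions one at a time.
  H⊆ : ∀ d L p {s} → p < n → (∀ j → j ≤ d → vertexAt L (p + j) ∈ s) → H d L (p mod n) ⊆ s
  H⊆ d L p {s} p<n in-s = verticesAt⊆ L _ (step ∘ ∈-map⁻ _)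
    where
    step : ∀ {i} → ∃[ j ] (j ∈ˡ upTo (suc d) × i ≡ (toℕ (p mod n) + j) mod n) → L ⟨$⟩ˡ i ∈ s
    step (j , j∈ , refl) =
      subst (λ q → vertexAt L (q + j) ∈ s) (sym (toℕ-mod p<n)) (in-s j (s≤s⁻¹ (∈-upTo⁻ j∈)))

  -- Cyclic gaps of at most d both make neighbouring windows meet and leave no
  -- vertex uncovered.
  module Winding (Δ : SimplicialComplex n) {d : ℕ} (L : Labeling n) (m : ℕ) (f : ℕ → ℕ)
    (rises  : ∀ {a} → a < m → f a < f (suc a))
    (steps  : ∀ {a} → a < m → f (suc a) ≤ f a + d)
    (starts : f 0 < d)
    (ends   : f m ≡ n′)
    (isFace : ∀ {a} → a ≤ m → SimplicialComplex.Face Δ (H d L (f a mod n)))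
    where

    f-mono : ∀ {a} b → a ≤ b → b ≤ m → f a ≤ f b
    f-mono zero    z≤n   _   = ≤-refl
    f-mono (suc b) a≤1+b b<m with m≤n⇒m<n∨m≡n a≤1+b
    ... | inj₁ a<1+b = ≤-trans (f-mono b (s≤s⁻¹ a<1+b) (<⇒≤ b<m)) (<⇒≤ (rises b<m))
    ... | inj₂ refl  = ≤-refl

    f<n : ∀ {a} → a ≤ m → f a < n
    f<n a≤m = s≤s (≤-trans (f-mono m a≤m ≤-refl) (≤-reflexive ends))

    reach : ∀ {a p} → a ≤ m → f a ≤ p → p ≤ f a + d → vertexAt L p ∈ H d L (f a mod n)
    reach {a} a≤m fa≤p p≤fa+d with m≤n⇒∃[o]m+o≡n fa≤p
    ... | j , refl = vertexAt∈H d L (f a) (f<n a≤m) (+-cancelˡ-≤ (f a) j d p≤fa+d)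

    -- The window at `f m ≡ n′` continues through the positions 0, ..., d - 1. By `starts` these
    -- include `f 0` and everything before it.
    reach-wrap : ∀ {p} → p < d → vertexAt L p ∈ H d L (f m mod n)
    reach-wrap {p} p<d rewrite ends =
      subst (_∈ H d L (n′ mod n)) (vertexAt-wrap L p) (vertexAt∈H d L n′ ≤-refl p<d)

    -- Walk down from `b` until a start lies below `p`; then `p` is at most the next start, which
    -- `steps` keeps within `d`. If none lies below, `p` equals `f 0`.
    locate : ∀ {p} b → b ≤ m → f 0 ≤ p → p ≤ f b → ∃[ a ] (a ≤ m × f a ≤ p × p ≤ f a + d)
    locate zero    _   f0≤p p≤f0 = 0 , z≤n , f0≤p , ≤-trans p≤f0 (m≤m+n _ d)
    locate {p} (suc b) b<m f0≤p p≤ with p ≤? f b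
    ... | yes p≤fb = locate b (<⇒≤ b<m) f0≤p p≤fb
    ... | no  p≰fb = b , <⇒≤ b<m , <⇒≤ (≰⇒> p≰fb) , ≤-trans p≤ (steps b<m)

    covered : ∀ {p} → p < n → ∃[ a ] (a ≤ m × vertexAt L p ∈ H d L (f a mod n))
    covered {p} p<n with f 0 ≤? p
    ... | no  f0≰p = m , ≤-refl , reach-wrap (<-trans (≰⇒> f0≰p) starts)
    ... | yes f0≤p with locate m ≤-refl f0≤p (≤-trans (s≤s⁻¹ p<n) (≤-reflexive (sym ends)))
    ... | a , a≤m , fa≤p , p≤ = a , a≤m , reach a≤m fa≤p p≤

    weaklyHamiltonian : WeaklyHamiltonian Δ d
    weaklyHamiltonian = record
      { labeling    = L
      ; m           = m
      ; index       = λ a → f (toℕ a) mod n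
      ; increasing  = λ a b a<b → subst₂ _<_ (sym (toℕ-mod (f<n (≤m a)))) (sym (toℕ-mod (f<n (≤m b))))
          (<-≤-trans (rises (<-≤-trans a<b (≤m b))) (f-mono (toℕ b) a<b (≤m b)))
      ; faces       = λ a → isFace (≤m a)
      ; covers      = λ v → cover v (covered (toℕ<n (L ⟨$⟩ʳ v)))
      -- The common vertex is the first one of the later window.
      ; consecutive = λ j → subst (λ a → Nonempty (H d L (f a mod n) ∩ H d L (f (suc (toℕ j)) mod n)))
          (sym (toℕ-inject₁ j))
          (vertexAt L (f (suc (toℕ j))) , x∈p∩q⁺
            ( reach (<⇒≤ (toℕ<n j)) (<⇒≤ (rises (toℕ<n j))) (steps (toℕ<n j))
            , vertexAt∈H₀ d L _ (f<n (toℕ<n j))))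
      ; closing     = subst (λ a → Nonempty (H d L (f a mod n) ∩ H d L (f 0 mod n))) (sym (toℕ-fromℕ m))
          (vertexAt L (f 0) , x∈p∩q⁺ (reach-wrap starts , vertexAt∈H₀ d L _ (f<n z≤n)))
      }
      where
      ≤m : ∀ (a : Fin (suc m)) → toℕ a ≤ m
      ≤m a = s≤s⁻¹ (toℕ<n a)
      cover : ∀ v → ∃[ a ] (a ≤ m × vertexAt L (toℕ (L ⟨$⟩ʳ v)) ∈ H d L (f a mod n)) →
              ∃[ a ] v ∈ H d L (f (toℕ a) mod n)
      cover v (a , a≤m , v∈) = fromℕ< (s≤s a≤m) ,
        subst₂ (λ w b → w ∈ H d L (f b mod n)) (vertexAt-position L v) (sym (toℕ-fromℕ< (s≤s a≤m))) v∈

  -- Reversing the tail of a labeling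

  module Reversal (i : ℕ) where

    -- A reflected position and its image add up to `i + n′`, the sum of the first and the last
    -- position of the tail.
    reverse : Fin n → Fin n
    reverse p with toℕ p <? i
    ... | yes _ = p
    ... | no  _ = (i + n′ ∸ toℕ p) mod n

    reverse-head : ∀ p → toℕ p < i → reverse p ≡ p
    reverse-head p p<i with toℕ p <? i
    ... | yes _   = refl
    ... | no  p≮i = contradiction p<i p≮i

    -- Describing the reflection by a sum keeps truncated subtraction out of the arithmetic of the
    -- windows.
    reverse-tail : ∀ p {q} → i ≤ toℕ p → toℕ p + q ≡ i + n′ → reverse p ≡ q mod n
    reverse-tail p {q} i≤p eq with toℕ p <? i
    ... | yes p<i = contradiction p<i (≤⇒≯ i≤p)
    ... | no  _   = cong (_mod n) (trans (cong (_∸ toℕ p) (sym eq)) (m+n∸m≡n (toℕ p) q))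

    -- The equation p + q = i + n′ is symmetric in p and q, so in the tail only i ≤ q ≤ n′ has to be
    -- checked: the left bound comes from p ≤ n′, the right one from i ≤ p.
    reverse-involutive : ∀ p → reverse (reverse p) ≡ p
    reverse-involutive p with toℕ p <? i
    ... | yes p<i = reverse-head p p<i
    ... | no  p≮i with m≤n⇒∃[o]m+o≡n (≤-trans (s≤s⁻¹ (toℕ<n p)) (m≤n+m n′ i))
    ... | q , eq rewrite trans (cong (_∸ toℕ p) (sym eq)) (m+n∸m≡n (toℕ p) q) =
      trans (reverse-tail (q mod n) (subst (i ≤_) (sym toℕ-q) i≤q)
              (trans (cong (_+ toℕ p) toℕ-q) (trans (+-comm q (toℕ p)) eq)))
            (toℕ-mod-id p)
      where
      i≤q : i ≤ q
      i≤q = +-cancelʳ-≤ n′ i q (≤-trans (≤-reflexive (trans (sym eq) (+-comm (toℕ p) q)))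
              (+-monoʳ-≤ q (s≤s⁻¹ (toℕ<n p))))
      q≤n′ : q ≤ n′
      q≤n′ = +-cancelˡ-≤ i q n′ (≤-trans (+-monoˡ-≤ q (≮⇒≥ p≮i)) (≤-reflexive eq))
      toℕ-q : toℕ (q mod n) ≡ q
      toℕ-q = toℕ-mod (s≤s q≤n′)

    reverseTail : Labeling n → Labeling n
    reverseTail L = L ∘ₚ permutation reverse reverse reverse-involutive reverse-involutive

    head-vertexAt : ∀ L {p} → p < i → p < n → vertexAt (reverseTail L) p ≡ vertexAt L p
    head-vertexAt L {p} p<i p<n =
      cong (L ⟨$⟩ˡ_) (reverse-head (p mod n) (subst (_< i) (sym (toℕ-mod p<n)) p<i))

    tail-vertexAt : ∀ L {p q} → i ≤ p → p < n → p + q ≡ i + n′ → vertexAt (reverseTail L) p ≡ vertexAt L q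
    tail-vertexAt L {p} {q} i≤p p<n eq = cong (L ⟨$⟩ˡ_) (reverse-tail (p mod n)
      (subst (i ≤_) (sym (toℕ-mod p<n)) i≤p) (trans (cong (_+ q) (toℕ-mod p<n)) eq))

-- Positions count from 0, with d = suc d′, i = d + k and n = i + d + l.  The
-- chosen windows of the order 0, …, i - 1, n - 1, …, i start at 0, …, k - 1 in
-- the head, at i - 1 (this one is τ ∪ {i - 1}), …, n - d - 1 up to the end of
-- the reversed tail, and at n - 1 (this one wraps around and is σ ∪ {i}).
module Rotation (d′ k l : ℕ) where

  private
    d i n′ n : ℕ
    d  = suc d′
    i  = suc (d′ + k)
    n′ = d′ + k + d + l
    n  = suc n′

    n′≡i+ : n′ ≡ i + (d′ + l)
    n′≡i+ = eq d′ k l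
      where
      eq : ∀ d′ k l → d′ + k + suc d′ + l ≡ suc (d′ + k) + (d′ + l)
      eq = solve-∀

    n′≡k+l+ : n′ ≡ k + l + d′ + d
    n′≡k+l+ = eq d′ k l
      where
      eq : ∀ d′ k l → d′ + k + suc d′ + l ≡ k + l + d′ + suc d′
      eq = solve-∀

    i≤n′ : i ≤ n′
    i≤n′ = ≤-trans (m≤m+n i (d′ + l)) (≤-reflexive (sym n′≡i+))

  index : ℕ → ℕ
  index a with a <? k | a ≤? k + l
  ... | yes _ | _     = a
  ... | no  _ | yes _ = a + d′
  ... | no  _ | no  _ = n′

  index-head : ∀ {a} → a < k → index a ≡ a
  index-head {a} a<k with a <? k
  ... | yes _   = refl
  ... | no  a≮k = contradiction a<k a≮k

  index-tail : ∀ {a} → k ≤ a → a ≤ k + l → index a ≡ a + d′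
  index-tail {a} k≤a a≤k+l with a <? k | a ≤? k + l
  ... | yes a<k | _        = contradiction a<k (≤⇒≯ k≤a)
  ... | no  _   | yes _    = refl
  ... | no  _   | no a≰k+l = contradiction a≤k+l a≰k+l

  index-end : ∀ {a} → k + l < a → index a ≡ n′
  index-end {a} k+l<a with a <? k | a ≤? k + l
  ... | yes a<k | _         = contradiction (<-trans k+l<a a<k) (≤⇒≯ (m≤m+n k l))
  ... | no  _   | yes a≤k+l = contradiction k+l<a (≤⇒≯ a≤k+l)
  ... | no  _   | no _      = refl

  -- Starts increase by 1 except at two jumps of exactly `d`: from k - 1 to `k + d′`, present when 0
  -- < k, and from `k + l + d′` to `n′`.
  index-gap : ∀ {a} → a < suc (k + l) → index a < index (suc a) × index (suc a) ≤ index a + d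
  index-gap {a} a<m with <-≤-connex a k | <-≤-connex (suc a) k | ≤-<-connex (suc a) (k + l)
  ... | inj₁ a<k | inj₁ 1+a<k | _
    rewrite index-head a<k | index-head 1+a<k =
    ≤-refl , ≤-trans (s≤s (m≤m+n a d′)) (≤-reflexive (sym (+-suc a d′)))
  ... | inj₁ a<k | inj₂ k≤1+a | _
    rewrite index-head a<k | index-tail k≤1+a (≤-trans a<k (m≤m+n k l)) =
    s≤s (m≤m+n a d′) , ≤-reflexive (sym (+-suc a d′))
  ... | inj₂ k≤a | _ | inj₁ 1+a≤
    rewrite index-tail k≤a (<⇒≤ 1+a≤) | index-tail (m≤n⇒m≤1+n k≤a) 1+a≤ =
    ≤-refl , ≤-trans (s≤s (m≤m+n (a + d′) d′)) (≤-reflexive (sym (+-suc (a + d′) d′)))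
  ... | inj₂ k≤a | _ | inj₂ k+l<1+a with ≤-antisym (s≤s⁻¹ a<m) (s≤s⁻¹ k+l<1+a)
  ... | refl
    rewrite index-tail (m≤m+n k l) (≤-refl {k + l}) | index-end (≤-refl {suc (k + l)}) | n′≡k+l+ =
    ≤-trans (s≤s (m≤m+n (k + l + d′) d′)) (≤-reflexive (sym (+-suc (k + l + d′) d′))) , ≤-refl

  -- When `k` is 0 the first window starts at `d′`, the largest value allowed.
  index-start : index 0 < d
  index-start with <-≤-connex 0 k
  ... | inj₁ 0<k rewrite index-head 0<k = s≤s z≤n
  ... | inj₂ k≤0 rewrite index-tail k≤0 (z≤n {k + l}) = ≤-refl

  module _ (Δ : SimplicialComplex n) (L : Labeling n) (traces : MakesTraceable Δ d L)
    {s t : Subset n} (Face-s : SimplicialComplex.Face Δ s) (Face-t : SimplicialComplex.Face Δ t)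
    (first⊆s : firstVertices d L ⊆ s) (i∈s : vertexAt L i ∈ s)
    (last⊆t : lastVertices d L ⊆ t) (i-1∈t : vertexAt L (d′ + k) ∈ t)
    where

    open SimplicialComplex Δ
    open Reversal {n′} i

    private
      L′ : Labeling n
      L′ = reverseTail L

    Face-H : ∀ {p} → p + d < n → Face (H d L (p mod n))
    Face-H {p} p+d<n = traces (p mod n)
      (subst (λ q → q + d < n) (sym (toℕ-mod (≤-<-trans (m≤m+n p d) p+d<n))) p+d<n)

    -- The window ends before position `i`, where `L′` still agrees with `L`.
    Face-head : ∀ {a} → a < k → Face (H d L′ (a mod n))
    Face-head {a} a<k = closed (H⊆ d L′ a a<n in-H) (Face-H (<-trans a+d<i (s≤s i≤n′)))
      where
      a+d<i : a + d < i
      a+d<i = ≤-trans (+-monoˡ-≤ d a<k) (≤-reflexive (trans (+-suc k d′) (cong suc (+-comm k d′))))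
      a<n : a < n
      a<n = <-trans (≤-<-trans (m≤m+n a d) a+d<i) (s≤s i≤n′)
      in-H : ∀ j → j ≤ d → vertexAt L′ (a + j) ∈ H d L (a mod n)
      in-H j j≤d = subst (_∈ H d L (a mod n))
        (sym (head-vertexAt L a+j<i (<-trans a+j<i (s≤s i≤n′)))) (vertexAt∈H d L a a<n j≤d)
        where
        a+j<i : a + j < i
        a+j<i = ≤-<-trans (+-monoʳ-≤ a j≤d) a+d<i

    -- Position i - 1 is unmoved and the next `d` positions now carry the last `d` vertices in
    -- reverse, so the window lies in τ ∪ {i - 1}, hence in `t`.
    Face-turn : Face (H d L′ ((k + d′) mod n))
    Face-turn = subst (λ p → Face (H d L′ (p mod n))) (+-comm d′ k)
                  (closed (H⊆ d L′ (d′ + k) i-1<n in-t) Face-t)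
      where
      i-1<n : d′ + k < n
      i-1<n = <-trans ≤-refl (s≤s i≤n′)
      in-t : ∀ j → j ≤ d → vertexAt L′ (d′ + k + j) ∈ t
      in-t zero    _ = subst (_∈ t)
        (sym (trans (cong (vertexAt L′) (+-identityʳ (d′ + k))) (head-vertexAt L ≤-refl i-1<n)))
        i-1∈t
      -- `q` is n′ - j, the old position of the vertex now at i + j; since `j ≤ d′`, it is among the
      -- last `d` positions.
      in-t (suc j) (s≤s j≤d′) with m≤n⇒∃[o]m+o≡n
        (≤-trans j≤d′ (≤-trans (m≤n+m d′ (suc (k + l))) (≤-trans (m≤m+n _ d′) (≤-reflexive (eq d′ k l)))))
        where
        eq : ∀ d′ k l → suc (k + l) + d′ + d′ ≡ d′ + k + suc d′ + l
        eq = solve-∀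
      ... | q , j+q≡n′ = subst (_∈ t) (sym (tail-vertexAt L i≤p p<n p+q≡)) (last⊆t q∈)
        where
        i≤p : i ≤ d′ + k + suc j
        i≤p = ≤-trans (m≤m+n i j) (≤-reflexive (sym (+-suc (d′ + k) j)))
        p<n : d′ + k + suc j < n
        p<n = s≤s (≤-trans (+-monoʳ-≤ (d′ + k) (s≤s j≤d′)) (m≤m+n (d′ + k + d) l))
        p+q≡ : d′ + k + suc j + q ≡ i + n′
        p+q≡ = trans (cong (_+ q) (+-suc (d′ + k) j)) (trans (+-assoc i j q) (cong (i +_) j+q≡n′))
        q<n : q < n
        q<n = s≤s (≤-trans (m≤n+m q j) (≤-reflexive j+q≡n′))
        q∈ : vertexAt L q ∈ lastVertices d L
        q∈ = last⁺ d L (q mod n) (subst (λ x → n ≤ x + d) (sym (toℕ-mod q<n))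
          (≤-trans (s≤s (≤-trans (≤-reflexive (sym j+q≡n′)) (≤-trans (+-monoˡ-≤ q j≤d′) (≤-reflexive (+-comm d′ q)))))
            (≤-reflexive (sym (+-suc q d′)))))

    -- Windows inside the reversed tail are windows of `L` read backwards.
    Face-tail : ∀ {a} → k < a → a ≤ k + l → Face (H d L′ ((a + d′) mod n))
    Face-tail {a} k<a a≤k+l with m≤n⇒∃[o]m+o≡n k<a
    ... | c , refl with m≤n⇒∃[o]m+o≡n {suc c} {l} (+-cancelˡ-≤ k (suc c) l (≤-trans (≤-reflexive (+-suc k c)) a≤k+l))
    ... | e , refl = subst (λ p → Face (H d L′ (p mod n))) (p≡ d′ k c)
                       (closed (H⊆ d L′ p (≤-<-trans (m≤m+n p d) p+d<n) in-H) (Face-H {q} q+d<n))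
      where
      -- The new window at i + c reads the old positions from n′ - c down to n′ - c - d; the latter
      -- is `q` once `l` is written as `suc c + e`.
      p q : ℕ
      p = i + c
      q = k + e + d
      p≡ : ∀ d′ k c → suc (d′ + k) + c ≡ suc k + c + d′
      p≡ = solve-∀
      p+d<n : p + d < n
      p+d<n = s≤s (≤-trans (m≤m+n (p + d) e) (≤-reflexive (eq d′ k c e)))
        where
        eq : ∀ d′ k c e → suc (d′ + k) + c + suc d′ + e ≡ d′ + k + suc d′ + (suc c + e)
        eq = solve-∀
      q+d<n : q + d < n
      q+d<n = s≤s (≤-trans (m≤m+n (q + d) c) (≤-reflexive (eq d′ k c e)))
        where
        eq : ∀ d′ k c e → k + e + suc d′ + suc d′ + c ≡ d′ + k + suc d′ + (suc c + e)
        eq = solve-∀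
      in-H : ∀ j → j ≤ d → vertexAt L′ (p + j) ∈ H d L (q mod n)
      -- `j′` is d - j: an offset from the start of one window is an offset from the end of the
      -- other.
      in-H j j≤d with m≤n⇒∃[o]m+o≡n j≤d
      ... | j′ , j+j′≡d = subst (_∈ H d L (q mod n))
        (sym (tail-vertexAt L (≤-trans (m≤m+n i c) (m≤m+n p j)) (≤-<-trans (+-monoʳ-≤ p j≤d) p+d<n) p+j+q+j′≡))
        (vertexAt∈H d L q (≤-<-trans (m≤m+n q d) q+d<n) (≤-trans (m≤n+m j′ j) (≤-reflexive j+j′≡d)))
        where
        p+j+q+j′≡ : p + j + (q + j′) ≡ i + n′
        p+j+q+j′≡ = trans (shuffle p j q j′) (trans (cong (p + q +_) j+j′≡d) (eq d′ k c e))
          where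
          shuffle : ∀ p j q j′ → p + j + (q + j′) ≡ p + q + (j + j′)
          shuffle = solve-∀
          eq : ∀ d′ k c e → suc (d′ + k) + c + (k + e + suc d′) + suc d′ ≡ suc (d′ + k) + (d′ + k + suc d′ + (suc c + e))
          eq = solve-∀

    -- The reflection brings the vertex at `i` to the last position; after it the window wraps
    -- around into the first `d` positions, which are untouched because d ≤ i. So it lies in σ ∪
    -- {i}, hence in `s`.
    Face-end : Face (H d L′ (n′ mod n))
    Face-end = closed (H⊆ d L′ n′ ≤-refl in-s) Face-s
      where
      in-s : ∀ j → j ≤ d → vertexAt L′ (n′ + j) ∈ s
      in-s zero    _ = subst (_∈ s)
        (sym (trans (cong (vertexAt L′) (+-identityʳ n′)) (tail-vertexAt L i≤n′ ≤-refl (+-comm n′ i)))) i∈s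
      in-s (suc j) j<d = subst (_∈ s)
        (sym (trans (vertexAt-wrap L′ j) (head-vertexAt L j<i j<n)))
        (first⊆s (first⁺ d L (j mod n) (subst (_< d) (sym (toℕ-mod j<n)) j<d)))
        where
        j<i : j < i
        j<i = ≤-trans j<d (s≤s (m≤m+n d′ k))
        j<n : j < n
        j<n = <-trans j<i (s≤s i≤n′)

    Face-index : ∀ {a} → a ≤ suc (k + l) → Face (H d L′ (index a mod n))
    Face-index {a} a≤m with a <? k | a ≤? k + l
    ... | yes a<k | _        = Face-head a<k
    ... | no  _   | no _     = Face-end
    ... | no  a≮k | yes a≤k+l with m≤n⇒m<n∨m≡n (≮⇒≥ a≮k)
    ... | inj₁ k<a  = Face-tail k<a a≤k+l
    ... | inj₂ refl = Face-turn

    rotation-weaklyHamiltonian : WeaklyHamiltonian Δ d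
    rotation-weaklyHamiltonian = Winding.weaklyHamiltonian Δ L′ (suc (k + l)) index
      (proj₁ ∘ index-gap) (proj₂ ∘ index-gap) index-start (index-end ≤-refl) Face-index

-- Degrees

module _ {n} (Δ : SimplicialComplex n) where
  open SimplicialComplex Δ

  -- Degrees count faces, while the pigeonhole argument works with positions of vertices; so each
  -- counted face is represented by one of its vertices outside `ρ`.
  record Extensions (d : ℕ) (ρ : Subset n) : Set where
    field
      vertex    : Fin (degree Δ d ρ) → Fin n
      injective : Injective _≡_ _≡_ vertex
      fresh     : ∀ x → vertex x ∉ ρ
      extended  : ∀ x → ∃[ s ] (Face s × ρ ⊆ s × vertex x ∈ s)

  -- A counted face has one element more than `ρ`, so it contains a new vertex and equals `ρ` with
  -- that vertex added. The vertex thus determines the face, which gives injectivity.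
  extensions : ∀ {d} ρ → ∣ ρ ∣ ≡ d → Extensions d ρ
  extensions {d} ρ ∣ρ∣≡d = record
    { vertex    = v
    ; injective = λ {x} {y} vx≡vy → lookup-injective (Unique.filter⁺ P? (subsets-unique n))
        (trans (sym (span x)) (trans (cong (λ w → ⁅ w ⁆ ∪ ρ) vx≡vy) (span y)))
    ; fresh     = λ x → proj₂ (proj₂ (new x))
    ; extended  = λ x → face x , proj₁ (proj₁ (good x)) , proj₂ (good x) , proj₁ (proj₂ (new x))
    }
    where
    P : Pred (Subset n) 0ℓ
    P s = (Face s × ∣ s ∣ ≡ suc d) × ρ ⊆ s
    P? : Decidable P
    P? s = (Face? s ×-dec (∣ s ∣ ≟ suc d)) ×-dec (ρ ⊆? s)
    face : Fin (degree Δ d ρ) → Subset n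
    face = lookup (filter P? (subsets n))
    good : ∀ x → P (face x)
    good x = proj₂ (∈-filter⁻ P? {xs = subsets n} (∈-lookup x))
    new : ∀ x → ∃[ w ] (w ∈ face x × w ∉ ρ)
    new x = ∣p∣<∣q∣⇒∃ ρ (face x) (≤-reflexive (trans (cong suc ∣ρ∣≡d) (sym (proj₂ (proj₁ (good x))))))
    v : Fin (degree Δ d ρ) → Fin n
    v x = proj₁ (new x)
    span : ∀ x → ⁅ v x ⁆ ∪ ρ ≡ face x
    span x = p⊆q∧∣q∣≤∣p∣⇒p≡q
      (λ w∈ → [ (λ w∈v → subst (_∈ face x) (sym (x∈⁅y⁆⇒x≡y _ w∈v)) (proj₁ (proj₂ (new x)))) , proj₂ (good x) ]′
                (x∈p∪q⁻ ⁅ v x ⁆ ρ w∈))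
      (≤-trans (≤-reflexive (trans (proj₂ (proj₁ (good x))) (cong suc (sym ∣ρ∣≡d))))
        (p⊂q⇒∣p∣<∣q∣ (q⊆p∪q ⁅ v x ⁆ ρ , v x , x∈p∪q⁺ (inj₁ (x∈⁅x⁆ _)) , proj₂ (proj₂ (new x)))))

  -- The face `s₀` has the largest possible cardinality, so it is a facet; by purity every facet has
  -- `d + 1` elements like `s₀`, and those containing `ρ` are counted by the degree.
  facetsContaining≤degree : ∀ {d} → HasDimension Δ d → Pure Δ → ∀ ρ → facetsContaining Δ ρ ≤ degree Δ d ρ
  facetsContaining≤degree ((s₀ , Face-s₀ , ∣s₀∣) , bound) pure ρ =
    length-filter-mono _ _ (λ { (facet , ρ⊆s) → (proj₁ facet , trans (pure _ s₀ facet facet₀) ∣s₀∣) , ρ⊆s }) (subsets n)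
    where
    facet₀ : IsFacet Δ s₀
    facet₀ = Face-s₀ , λ t Face-t s₀⊆t → p⊆q∧∣q∣≤∣p∣⇒p≡q s₀⊆t (≤-trans (bound t Face-t) (≤-reflexive (sym ∣s₀∣)))

-- Crossing faces at the two ends of the path

record Crossing {n′} (Δ : SimplicialComplex (suc n′)) (d : ℕ) (L : Labeling (suc n′)) : Set where
  open SimplicialComplex Δ
  field
    i-1     : ℕ
    -- The next two bounds hold because the extra vertices lie outside σ and τ; they allow i to be
    -- written as d + k and n as i + d + l.
    d≤i     : d ≤ suc i-1
    i+d≤n   : i-1 + d ≤ n′
    {s t}   : Subset (suc n′)
    Face-s  : Face s
    Face-t  : Face t
    first⊆s : firstVertices d L ⊆ s
    i∈s     : vertexAt L (suc i-1) ∈ s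
    last⊆t  : lastVertices d L ⊆ t
    i-1∈t   : vertexAt L i-1 ∈ t

module _ {n′} (Δ : SimplicialComplex (suc n′)) where
  open SimplicialComplex Δ

  private
    n : ℕ
    n = suc n′

  crossing : ∀ {d} L → 1 ≤ d → Extensions Δ d (firstVertices d L) → Extensions Δ d (lastVertices d L) →
             n ≤ degree Δ d (firstVertices d L) + degree Δ d (lastVertices d L) → Crossing Δ d L
  crossing {d} L 1≤d first-ext last-ext n≤deg = found (injections-meet f g f-inj g-inj n≤deg)
    where
    open Extensions first-ext
      renaming (vertex to v; injective to v-inj; fresh to v-fresh; extended to v-ext)
    open Extensions last-ext
      renaming (vertex to w; injective to w-inj; fresh to w-fresh; extended to w-ext)

    pos : Fin n → ℕ
    pos u = toℕ (L ⟨$⟩ʳ u)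

    pos-injective : Injective _≡_ _≡_ pos
    pos-injective eq = trans (sym (inverseˡ L)) (trans (cong (L ⟨$⟩ˡ_) (toℕ-injective eq)) (inverseˡ L))

    d≤pos-v : ∀ x → d ≤ pos (v x)
    d≤pos-v x = ≮⇒≥ λ pos<d → v-fresh x (subst (_∈ _) (inverseˡ L) (first⁺ d L _ pos<d))

    pos-w+d<n : ∀ y → pos (w y) + d < n
    pos-w+d<n y = ≰⇒> λ n≤ → w-fresh y (subst (_∈ _) (inverseˡ L) (last⁺ d L _ n≤))

    -- This makes `pos (v x) ∸ 1` a genuine shift, so that it stays injective.
    1≤pos-v : ∀ x → 1 ≤ pos (v x)
    1≤pos-v x = ≤-trans 1≤d (d≤pos-v x)

    f< : ∀ x → pos (v x) ∸ 1 < n′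
    f< x = ∸-monoˡ-< (toℕ<n (L ⟨$⟩ʳ v x)) (1≤pos-v x)

    g< : ∀ y → pos (w y) < n′
    g< y = s≤s⁻¹ (≤-trans (s≤s (≤-trans (≤-reflexive (+-comm 1 (pos (w y)))) (+-monoʳ-≤ (pos (w y)) 1≤d))) (pos-w+d<n y))

    -- Both maps take values among `n′` places, while the two degrees together supply at least
    -- `n′ + 1` arguments.
    f : Fin (degree Δ d (firstVertices d L)) → Fin n′
    f x = fromℕ< (f< x)
    g : Fin (degree Δ d (lastVertices d L)) → Fin n′
    g y = fromℕ< (g< y)

    f-inj : Injective _≡_ _≡_ f
    f-inj {x} {y} eq = v-inj (pos-injective (∸-cancelʳ-≡ (1≤pos-v x) (1≤pos-v y)
      (trans (sym (toℕ-fromℕ< (f< x))) (trans (cong toℕ eq) (toℕ-fromℕ< (f< y))))))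

    g-inj : Injective _≡_ _≡_ g
    g-inj {x} {y} eq = w-inj (pos-injective
      (trans (sym (toℕ-fromℕ< (g< x))) (trans (cong toℕ eq) (toℕ-fromℕ< (g< y)))))

    found : ∃[ x ] ∃[ y ] f x ≡ g y → Crossing Δ d L
    found (x , y , fx≡gy) with v-ext x | w-ext y
    ... | s , Face-s , first⊆s , v∈s | t , Face-t , last⊆t , w∈t = record
      { i-1     = pos (w y)
      ; d≤i     = subst (d ≤_) pos-v≡ (d≤pos-v x)
      ; i+d≤n   = s≤s⁻¹ (pos-w+d<n y)
      ; Face-s  = Face-s
      ; Face-t  = Face-t
      ; first⊆s = first⊆s
      ; i∈s     = subst (_∈ s) (trans (sym (vertexAt-position L (v x))) (cong (vertexAt L) pos-v≡)) v∈s
      ; last⊆t  = last⊆t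
      ; i-1∈t   = subst (_∈ t) (sym (vertexAt-position L (w y))) w∈t
      }
      where
      pos-v≡ : pos (v x) ≡ suc (pos (w y))
      pos-v≡ = trans (sym (m+[n∸m]≡n (1≤pos-v x)))
        (cong suc (trans (sym (toℕ-fromℕ< (f< x))) (trans (cong toℕ fx≡gy) (toℕ-fromℕ< (g< y)))))

  first-face : ∀ {d} L → d < n → MakesTraceable Δ d L → Face (firstVertices d L)
  first-face {d} L d<n traces = closed
    (λ {v} v∈ → subst (_∈ H d L Fin.zero) (vertexAt-position L v)
      (vertexAt∈H d L 0 (s≤s z≤n) (<⇒≤ (first⁻ d L v∈))))
    (traces Fin.zero d<n)

  -- τ is contained in the last window that does not wrap around, which starts at `n′ ∸ d`.
  last-face : ∀ {d} L → d < n → MakesTraceable Δ d L → Face (lastVertices d L)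
  last-face {d} L d<n traces = closed in-H
    (traces (q mod n) (≤-reflexive (cong suc (trans (cong (_+ d) (toℕ-mod q<n)) q+d≡n′))))
    where
    q : ℕ
    q = n′ ∸ d
    q+d≡n′ : q + d ≡ n′
    q+d≡n′ = m∸n+n≡m (s≤s⁻¹ d<n)
    q<n : q < n
    q<n = s≤s (m∸n≤m n′ d)
    in-H : lastVertices d L ⊆ H d L (q mod n)
    in-H {v} v∈ with m≤n⇒∃[o]m+o≡n {q} {toℕ (L ⟨$⟩ʳ v)}
      (+-cancelʳ-≤ d q _ (≤-trans (≤-reflexive q+d≡n′) (<⇒≤ (last⁻ d L v∈))))
    ... | j , q+j≡ = subst (_∈ H d L (q mod n)) (trans (cong (vertexAt L) q+j≡) (vertexAt-position L v))
      (vertexAt∈H d L q q<n (+-cancelˡ-≤ q j d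
        (≤-trans (≤-reflexive q+j≡) (≤-trans (s≤s⁻¹ (toℕ<n _)) (≤-reflexive (sym q+d≡n′))))))

-- From a crossing to weak Hamiltonicity

crossing⇒weaklyHamiltonian : ∀ {n′ d′} (Δ : SimplicialComplex (suc n′)) L →
  MakesTraceable Δ (suc d′) L → Crossing Δ (suc d′) L → WeaklyHamiltonian Δ (suc d′)
crossing⇒weaklyHamiltonian {n′} {d′} Δ L traces record
  { i-1 = i-1 ; d≤i = d≤i ; i+d≤n = i+d≤n ; Face-s = Face-s ; Face-t = Face-t
  ; first⊆s = first⊆s ; i∈s = i∈s ; last⊆t = last⊆t ; i-1∈t = i-1∈t }
  -- Here `k` is i - d and, in the next match, `l` is n - i - d; matching on `refl` brings `n′` into
  -- the form that `Rotation` expects.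
  with m≤n⇒∃[o]m+o≡n (s≤s⁻¹ d≤i)
... | k , refl with m≤n⇒∃[o]m+o≡n i+d≤n
... | l , refl = Rotation.rotation-weaklyHamiltonian d′ k l Δ L traces
                   Face-s Face-t first⊆s i∈s last⊆t i-1∈t

n≤2a∧n≤2b⇒n≤a+b : ∀ {n} a b → n ≤ 2 * a → n ≤ 2 * b → n ≤ a + b
n≤2a∧n≤2b⇒n≤a+b a b n≤2a n≤2b with ≤-total a b
... | inj₁ a≤b = ≤-trans n≤2a (+-monoʳ-≤ a (≤-trans (≤-reflexive (+-identityʳ a)) a≤b))
... | inj₂ b≤a = ≤-trans n≤2b (+-mono-≤ b≤a (≤-reflexive (+-identityʳ b)))

theorem1 : ∀ (d n : ℕ) → 1 ≤ d → 2 * d < n →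
    (Δ : SimplicialComplex n) → HasDimension Δ d → Traceable Δ d →
    ((∃[ L ] (MakesTraceable Δ d L × n ≤ degree Δ d (firstVertices d L) + degree Δ d (lastVertices d L))) →
    WeaklyHamiltonian Δ d)
    ×
    (Pure Δ →
    (∀ (ρ : Subset n) → SimplicialComplex.Face Δ ρ → ∣ ρ ∣ ≡ d → n ≤ 2 * facetsContaining Δ ρ) →
    WeaklyHamiltonian Δ d)
theorem1 (suc d′) (suc n′) 1≤d 2d<n Δ dim (L₀ , traces₀) = part₁ , part₂
  where
  d = suc d′
  n = suc n′

  d<n : d < n
  d<n = ≤-<-trans (m≤m+n d (d + 0)) 2d<n

  part₁ : (∃[ L ] (MakesTraceable Δ d L × n ≤ degree Δ d (firstVertices d L) + degree Δ d (lastVertices d L))) →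
          WeaklyHamiltonian Δ d
  part₁ (L , traces , n≤deg) = crossing⇒weaklyHamiltonian Δ L traces (crossing Δ L 1≤d
    (extensions Δ _ (∣first∣ d L (<⇒≤ d<n))) (extensions Δ _ (∣last∣ d L (<⇒≤ d<n))) n≤deg)

  part₂ : Pure Δ → (∀ ρ → SimplicialComplex.Face Δ ρ → ∣ ρ ∣ ≡ d → n ≤ 2 * facetsContaining Δ ρ) →
          WeaklyHamiltonian Δ d
  -- Any labeling that makes `Δ` traceable will do: its σ and τ are then faces, so `many` bounds
  -- both of their degrees.
  part₂ pure many = part₁ (L₀ , traces₀ , ≤-trans
    (n≤2a∧n≤2b⇒n≤a+b (facetsContaining Δ σ) (facetsContaining Δ τ)
      (many σ (first-face Δ L₀ d<n traces₀) (∣first∣ d L₀ (<⇒≤ d<n)))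
      (many τ (last-face Δ L₀ d<n traces₀) (∣last∣ d L₀ (<⇒≤ d<n))))
    (+-mono-≤ (facetsContaining≤degree Δ dim pure σ) (facetsContaining≤degree Δ dim pure τ)))
    where
    σ τ : Subset n
    σ = firstVertices d L₀
    τ = lastVertices d L₀
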